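{- Let $p$ be a prime with $p>48$, let $N$ be a multiple of $p^2$, and let $F:\mathbb{B}\to(\mathbb{Z}/p\mathbb{Z})^\times$ be an $\mathcal{S}_{p,N}$-Sudoku solution with non-constant columns. Then for every integer $r\ge0$ there exist integers $A,B,C$ with $p\nmid B$ such that $F(n,m)=f_p(An+Bm+C)$ whenever $(n,m)\in\mathbb{B}$ satisfies $\nu_p(An+Bm+C)\le r$.
   Context: $\pi_p:\mathbb{Z}\to\mathbb{Z}/p\mathbb{Z}$ is reduction mod $p$, $(\mathbb{Z}/p\mathbb{Z})^\times=(\mathbb{Z}/p\mathbb{Z})\setminus\{0\}$, $\nu_p$ is the $p$-adic valuation with $\nu_p(0)=+\infty$. Define $f_p(n)=\pi_p(n/p^{\nu_p(n)})$ for $n\ne0$ and $f_p(0)=1\bmod p$. The Sudoku board is $\mathbb{B}=\{0,\dots,N-1\}\times\mathbb{Z}$. The Sudoku rule $\mathcal{S}_{p,N}$ is the set of functions $g:\{0,\dots,N-1\}\to(\mathbb{Z}/p\mathbb{Z})^\times$ for which there exist integers $a,b$, not both divisible by $p$, such that $g(n)=f_p(an+b)$ for all $n\in\{0,\dots,N-1\}$ with $\nu_p(an+b)\le1$. An $\mathcal{S}_{p,N}$-Sudoku solution is $F:\mathbb{B}\to(\mathbb{Z}/p\mathbb{Z})^\times$ such that for all $j,i\in\mathbb{Z}$ the function $n\mapsto F(n,jn+i)$ lies in $\mathcal{S}_{p,N}$. $F$ has non-constant columns if for every $n\in\{0,\dots,N-1\}$, $m\mapsto F(n,m)$ is non-constant.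 -}

module Defs where

open import Data.Nat as ℕ using (ℕ; zero; suc; NonZero; _<_; _≤_)
open import Data.Nat.DivMod using (_/_)
open import Data.Nat.Divisibility using (_∣?_)
open import Data.Integer as ℤ using (ℤ; +_; ∣_∣; sign; _◃_; _%ℕ_)
import Data.Integer.Divisibility as ℤD
open import Data.Product using (Σ; ∃; _×_; _,_; proj₁; proj₂)
open import Data.Maybe using (Maybe; just; nothing)
open import Relation.Nullary using (¬_; yes; no)
open import Relation.Binary.PropositionalEquality using (_≡_; _≢_)

-- Residues of ℤ/pℤ are represented by natural numbers in [0, p).

-- stripAux p k n = (number of factors p removed from n, remaining cofactor),
-- with fuel k.  With fuel ≥ n (and p ≥ 2) all factors p of n ≠ 0 are removed.
stripAux : (p : ℕ) .{{_ : NonZero p}} → ℕ → ℕ → ℕ × ℕ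
stripAux p zero    n = 0 , n
stripAux p (suc k) zero = 0 , zero
stripAux p (suc k) (suc n) with p ∣? suc n
... | yes _ = let r = stripAux p k (suc n / p) in suc (proj₁ r) , proj₂ r
... | no  _ = 0 , suc n

-- p-adic valuation of an integer; nothing stands for ν_p(0) = +∞.
ν : (p : ℕ) .{{_ : NonZero p}} → ℤ → Maybe ℕ
ν p (+ zero) = nothing
ν p x        = just (proj₁ (stripAux p ∣ x ∣ ∣ x ∣))

νLe : (p : ℕ) .{{_ : NonZero p}} → ℕ → ℤ → Set
νLe p r x with ν p x
... | nothing = Data.Empty.⊥ where import Data.Empty
... | just v  = v ≤ r

fp : (p : ℕ) .{{_ : NonZero p}} → ℤ → ℕ
fp p (+ zero) = 1 ℕ.% p
fp p x        = (sign x ◃ proj₂ (stripAux p ∣ x ∣ ∣ x ∣)) %ℕ p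

-- g : {0,…,N-1} → (ℤ/pℤ)^× belongs to the Sudoku rule 𝒮_{p,N}
-- (g is given as a function on ℕ; only its values on n < N matter).
InRule : (p : ℕ) .{{_ : NonZero p}} → (N : ℕ) → (ℕ → ℕ) → Set
InRule p N g =
  Σ ℤ λ a → Σ ℤ λ b →
    ¬ ((+ p ℤD.∣ a) × (+ p ℤD.∣ b)) ×
    ((n : ℕ) → n < N → νLe p 1 (a ℤ.* + n ℤ.+ b) → g n ≡ fp p (a ℤ.* + n ℤ.+ b))

-- F : 𝔹 = {0,…,N-1} × ℤ → (ℤ/pℤ)^×  (values of F at n ≥ N are irrelevant)
ValuedInUnits : (p N : ℕ) → (ℕ → ℤ → ℕ) → Set
ValuedInUnits p N F = (n : ℕ) → n < N → (m : ℤ) → (F n m < p) × (F n m ≢ 0)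

SudokuSolution : (p : ℕ) .{{_ : NonZero p}} → (N : ℕ) → (ℕ → ℤ → ℕ) → Set
SudokuSolution p N F = (j i : ℤ) → InRule p N (λ n → F n (j ℤ.* + n ℤ.+ i))

NonConstantColumns : (N : ℕ) → (ℕ → ℤ → ℕ) → Set
NonConstantColumns N F = (n : ℕ) → n < N → Σ ℤ λ m → Σ ℤ λ m' → F n m ≢ F n m'

{-# OPTIONS --safe #-}

-- Each line of the board carries an affine function αn + β mod p, not identically zero, with
-- which F agrees except in the single class of columns mod p where αn + β vanishes.  Two such
-- functions agreeing with F in four columns distinct mod p coincide.  Crossing rows with two
-- adjacent diagonals and an antidiagonal, the affine function of row m satisfies an equation
-- quadratic in m; three rows kill the leading coefficient, which makes F affine on these rows.
-- Lines of slope ±1 then spread this to every row, so F = An + Bm + C mod p wherever the right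
-- side is a unit.  Non-constant columns force p ∤ B.  On the remaining points, where
-- m = αn + γ + p m', the function F'(n, m') = F(n, m) is again a solution, and the
-- second level of a single line shows that F' has the same B mod p; induction on r follows.

module Submission where

open import Defs
open import Data.Empty using (⊥)
open import Data.Nat as ℕ using (ℕ; zero; suc; NonZero; _<_; _*_; z≤n; s≤s)
import Data.Nat.Properties as ℕP
import Data.Nat.DivMod as ℕDM
open import Data.Nat.Coprimality using (prime⇒coprime; coprime-Bézout)
open import Data.Nat.GCD using (module Bézout)
open import Data.Nat.Divisibility using (_∣_; divides; ∣⇒≤)
import Data.Nat.Divisibility as ℕD
open import Data.Nat.Primality using (Prime; euclidsLemma)
open import Data.Integer as ℤ using (ℤ; +_; -[1+_]; ∣_∣; _+_; _-_; -_; 0ℤ; 1ℤ; -1ℤ; sign; _◃_; _%ℕ_; _/ℕ_) renaming (_*_ to _·_)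
import Data.Integer.Divisibility as ℤD
import Data.Integer.Divisibility.Signed as ℤS
import Data.Integer.DivMod as ℤDM
import Data.Integer.Properties as ℤP
import Data.Sign.Properties as SignP
open import Data.Integer.Tactic.RingSolver using (solve-∀)
open import Data.List using (List; []; _∷_; length; filter; map; upTo)
import Data.List.Properties as ListP
open import Data.List.Relation.Unary.All as All using (All; []; _∷_)
import Data.List.Relation.Unary.All.Properties as AllP
open import Data.List.Relation.Unary.AllPairs as AllPairs using (AllPairs; []; _∷_)
import Data.List.Relation.Unary.AllPairs.Properties as AllPairsP
open import Data.Product as Product using (Σ; _×_; _,_; proj₁; proj₂)
open import Data.Sum using (_⊎_; inj₁; inj₂)
open import Function using (_∘_)
open import Relation.Binary.PropositionalEquality using (_≡_; _≢_; refl; sym; trans; cong; cong₂; subst; module ≡-Reasoning)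
open import Relation.Nullary using (¬_; Dec; yes; no; ¬?; contradiction)
open import Relation.Nullary.Decidable using (from-yes; _×-dec_)
open import Relation.Unary using (Decidable)

-- Finite samples and counting.

private
  variable
    X Y       : Set
    R R'      : X → X → Set
    P Q Q₁ Q₂ : X → Set
    k         : ℕ

AtMostOne : (X → X → Set) → (X → Set) → Set
AtMostOne R P = ∀ x y → R x y → P x → P y → ⊥

-- The first hit settles the rest: every later entry is `R`-related to it, hence fails `P`, so the
-- filter keeps the whole tail.
length-filter-AtMostOne : (P? : Decidable P) → AtMostOne R P →
  ∀ {xs} → AllPairs R xs → length xs ℕ.≤ suc (length (filter (¬? ∘ P?) xs))
length-filter-AtMostOne P? one [] = z≤n
length-filter-AtMostOne P? one {x ∷ xs} (rx ∷ rxs) with P? x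
... | no _   = s≤s (length-filter-AtMostOne P? one rxs)
... | yes px = s≤s (ℕP.≤-reflexive (cong length (sym
  (ListP.filter-all (¬? ∘ P?) (All.map (λ {y} r py → one x y r px py) rx)))))

record Sample {X : Set} (R : X → X → Set) (Q : X → Set) (k : ℕ) : Set where
  constructor sample
  field
    elems : List X
    pairs : AllPairs R elems
    long  : k ℕ.≤ length elems
    holds : All Q elems

refine : (∀ {x} → Q₁ x → Q₂ x) → Sample R Q₁ k → Sample R Q₂ k
refine f (sample xs rs l q) = sample xs rs l (All.map f q)

image : (f : X → Y) → (∀ x y → R x y → R' (f x) (f y)) → (∀ {x} → P x → Q (f x)) →
  Sample R P k → Sample R' Q k
image {k = k} f r q (sample xs rs l qs) = sample
  (map f xs) (AllPairsP.map⁺ (AllPairs.map (λ {x} {y} → r x y) rs))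
  (subst (k ℕ.≤_) (sym (ListP.length-map f xs)) l) (AllP.map⁺ (All.map q qs))

discard : (P? : Decidable P) → AtMostOne R P → Sample R Q (suc k) → Sample R (λ x → ¬ P x × Q x) k
discard P? one (sample xs rs l q) = sample
  (filter (¬? ∘ P?) xs) (AllPairsP.filter⁺ (¬? ∘ P?) rs)
  (ℕP.≤-pred (ℕP.≤-trans l (length-filter-AtMostOne P? one rs)))
  (All.zip (AllP.all-filter (¬? ∘ P?) xs , AllP.filter⁺ (¬? ∘ P?) q))

-- Pigeonhole: if one part has at most `k` of the `2k + 1` entries, the other has at least `k + 1`.
majority : {X : Set} {R : X → X → Set} {Q Q₁ Q₂ : X → Set} → ∀ k → (∀ {x} → Q x → Q₁ x ⊎ Q₂ x) →
  Sample R Q (suc (k ℕ.+ k)) → Sample R Q₁ (suc k) ⊎ Sample R Q₂ (suc k)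
majority {X} {R} {Q} {Q₁} {Q₂} k split (sample xs rs l q) = pick (halve rs q)
  where
  Halves : List X → Set₁
  Halves xs = Σ (List X) λ ys → Σ (List X) λ zs →
    length xs ≡ length ys ℕ.+ length zs ×
    (AllPairs R ys × All Q₁ ys) × (AllPairs R zs × All Q₂ zs) ×
    -- Carried along for `T = R x`: a new head `x` must stay related to the part it joins.
    (∀ {T : X → Set} → All T xs → All T ys × All T zs)

  halve : ∀ {xs} → AllPairs R xs → All Q xs → Halves xs
  halve [] [] = [] , [] , refl , ([] , []) , ([] , []) , λ _ → [] , []
  halve {x ∷ _} (r ∷ rs) (qx ∷ qs) with halve rs qs | split qx
  ... | ys , zs , e , (ry , qy) , (rz , qz) , t | inj₁ q₁ =
    x ∷ ys , zs , cong suc e , (proj₁ (t r) ∷ ry , q₁ ∷ qy) , (rz , qz) ,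
    λ { (tx ∷ ts) → tx ∷ proj₁ (t ts) , proj₂ (t ts) }
  ... | ys , zs , e , (ry , qy) , (rz , qz) , t | inj₂ q₂ =
    ys , x ∷ zs , trans (cong suc e) (sym (ℕP.+-suc _ _)) , (ry , qy) , (proj₂ (t r) ∷ rz , q₂ ∷ qz) ,
    λ { (tx ∷ ts) → proj₁ (t ts) , tx ∷ proj₂ (t ts) }

  pick : Halves xs → Sample R Q₁ (suc k) ⊎ Sample R Q₂ (suc k)
  pick (ys , zs , e , (ry , qy) , (rz , qz) , _) with suc k ℕ.≤? length ys
  ... | yes ly = inj₁ (sample ys ry ly qy)
  ... | no ¬ly = inj₂ (sample zs rz lz qz)
    where
    lz : suc k ℕ.≤ length zs
    lz = ℕP.+-cancelˡ-≤ k _ _ (ℕP.≤-trans (ℕP.≤-trans (ℕP.≤-reflexive (ℕP.+-suc k k))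
      (ℕP.≤-trans l (ℕP.≤-reflexive e))) (ℕP.+-monoˡ-≤ _ (ℕP.≤-pred (ℕP.≰⇒> ¬ly))))

module Solution (p : ℕ) .{{_ : NonZero p}} (p-prime : Prime p) (48<p : 48 < p) where

  -- Divisibility by `p` and incongruence.

  infix 4 p∣_
  p∣_ : ℤ → Set
  p∣ x = (+ p) ℤS.∣ x

  p∣?_ : ∀ x → Dec (p∣ x)
  p∣? x = (+ p) ℤS.∣? x

  p∣-by : ∀ {x e} a → p∣ x → e ≡ a · x → p∣ e
  p∣-by a hx refl = ℤS.∣n⇒∣m*n a hx

  -- The usual form of a congruence argument below: an explicit linear combination of known
  -- multiples of `p`, with the identity left to the ring solver.
  p∣-by₂ : ∀ {x y e} a b → p∣ x → p∣ y → e ≡ a · x + b · y → p∣ e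
  p∣-by₂ a b hx hy refl = ℤS.∣m∣n⇒∣m+n (ℤS.∣n⇒∣m*n a hx) (ℤS.∣n⇒∣m*n b hy)

  p∣-euclid : ∀ x y → p∣ (x · y) → p∣ x ⊎ p∣ y
  p∣-euclid x y h with euclidsLemma ∣ x ∣ ∣ y ∣ p-prime (subst (p ∣_) (ℤP.abs-* x y) (ℤS.∣⇒∣ᵤ h))
  ... | inj₁ hx = inj₁ (ℤS.∣ᵤ⇒∣ hx)
  ... | inj₂ hy = inj₂ (ℤS.∣ᵤ⇒∣ hy)

  p∣-cancelˡ : ∀ x y → ¬ p∣ x → p∣ (x · y) → p∣ y
  p∣-cancelˡ x y ¬hx h with p∣-euclid x y h
  ... | inj₁ hx = contradiction hx ¬hx
  ... | inj₂ hy = hy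

  p∣x-y⇒p∣x⇒p∣y : ∀ x y → p∣ (x - y) → p∣ x → p∣ y
  p∣x-y⇒p∣x⇒p∣y x y h hx = p∣-by₂ 1ℤ -1ℤ hx h (eq x y)
    where
    eq : ∀ x y → y ≡ 1ℤ · x + -1ℤ · (x - y)
    eq = solve-∀

  0<∣x∣<p⇒p∤x : ∀ x → 0 < ∣ x ∣ → ∣ x ∣ < p → ¬ p∣ x
  0<∣x∣<p⇒p∤x x 0<x x<p h = ℕP.<⇒≱ x<p (∣⇒≤ {{ℕ.>-nonZero 0<x}} (ℤS.∣⇒∣ᵤ h))

  p∤2 : ¬ p∣ (+ 2)
  p∤2 = 0<∣x∣<p⇒p∤x (+ 2) (s≤s z≤n) (ℕP.≤-trans (from-yes (3 ℕ.≤? 49)) 48<p)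

  Distinct : ℤ → ℤ → Set
  Distinct x y = ¬ p∣ (x - y)

  -- Decidable without knowing `p`, so incongruence of concrete integers is settled by computation;
  -- the bound 48 is what `48 < p` allows.
  Close : ℤ → ℤ → Set
  Close x y = (0 < ∣ x - y ∣) × (∣ x - y ∣ ℕ.≤ 48)

  close? : ∀ x y → Dec (Close x y)
  close? x y = (0 ℕ.<? ∣ x - y ∣) ×-dec (∣ x - y ∣ ℕ.≤? 48)

  close⇒distinct : ∀ x y → Close x y → Distinct x y
  close⇒distinct x y (l , u) = 0<∣x∣<p⇒p∤x (x - y) l (ℕP.≤-<-trans u 48<p)

  allClose⇒allDistinct : ∀ {xs} → AllPairs Close xs → AllPairs Distinct xs
  allClose⇒allDistinct = AllPairs.map (λ {x} {y} → close⇒distinct x y)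

  -- Subtracting the two values gives `a · (x - y)`, so `p` divides `a`, and then also `b`.
  root-unique : ∀ a b → ¬ (p∣ a × p∣ b) → ∀ x y → Distinct x y →
    p∣ (a · x + b) → p∣ (a · y + b) → ⊥
  root-unique a b nz x y d hx hy with p∣-euclid a (x - y) (p∣-by₂ 1ℤ -1ℤ hx hy (eq a b x y))
    where
    eq : ∀ a b x y → a · (x - y) ≡ 1ℤ · (a · x + b) + -1ℤ · (a · y + b)
    eq = solve-∀
  ... | inj₂ h = d h
  ... | inj₁ h = nz (h , p∣-by₂ 1ℤ (- x) hx h (eq a b x))
    where
    eq : ∀ a b x → b ≡ 1ℤ · (a · x + b) + (- x) · a
    eq = solve-∀

  -- Agreement with an affine function away from its zeros mod `p`.

  Matches : ℤ → ℤ → Set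
  Matches u w = ¬ p∣ u → p∣ (u - w)

  Matches-resp : ∀ u v w → p∣ (u - v) → Matches u w → Matches v w
  Matches-resp u v w h fit ¬v = p∣-by₂ 1ℤ -1ℤ (fit (¬v ∘ p∣x-y⇒p∣x⇒p∣y u v h)) h (eq u v w)
    where
    eq : ∀ u v w → v - w ≡ 1ℤ · (u - w) + -1ℤ · (u - v)
    eq = solve-∀

  Fits : (ℤ → ℤ) → ℤ → ℤ → ℤ → Set
  Fits g a b x = Matches (a · x + b) (g x)

  Fits-resp : ∀ g a b c d x → p∣ (a - c) → p∣ (b - d) → Fits g a b x → Fits g c d x
  Fits-resp g a b c d x ha hb =
    Matches-resp (a · x + b) (c · x + d) (g x) (p∣-by₂ x 1ℤ ha hb (eq a b c d x))
    where
    eq : ∀ a b c d x → (a · x + b) - (c · x + d) ≡ x · (a - c) + 1ℤ · (b - d)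
    eq = solve-∀

  -- Each affine function has at most one root among the four points. At the two points left both
  -- equal `g`, and two values determine an affine function.
  Fits-unique : ∀ g a b c d → ¬ (p∣ a × p∣ b) → ¬ (p∣ c × p∣ d) →
    Sample Distinct (λ x → Fits g a b x × Fits g c d x) 4 → p∣ (a - c) × p∣ (b - d)
  Fits-unique g a b c d nz nz' xs
    with discard (λ x → p∣? (c · x + d)) (root-unique c d nz')
      (discard (λ x → p∣? (a · x + b)) (root-unique a b nz) xs)
  ... | sample [] _ () _
  ... | sample (_ ∷ []) _ (s≤s ()) _
  ... | sample (x ∷ y ∷ _) ((x≢y ∷ _) ∷ _) _ ((c∤x , a∤x , fx , fx') ∷ (c∤y , a∤y , fy , fy') ∷ _) = ha , hb
    where
    eq₀ : ∀ u v w → u - v ≡ 1ℤ · (u - w) + -1ℤ · (v - w)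
    eq₀ = solve-∀
    hx : p∣ ((a · x + b) - (c · x + d))
    hx = p∣-by₂ 1ℤ -1ℤ (fx a∤x) (fx' c∤x) (eq₀ (a · x + b) (c · x + d) (g x))
    hy : p∣ ((a · y + b) - (c · y + d))
    hy = p∣-by₂ 1ℤ -1ℤ (fy a∤y) (fy' c∤y) (eq₀ (a · y + b) (c · y + d) (g y))
    eq₁ : ∀ a b c d x y → (x - y) · (a - c) ≡ 1ℤ · ((a · x + b) - (c · x + d)) + -1ℤ · ((a · y + b) - (c · y + d))
    eq₁ = solve-∀
    ha : p∣ (a - c)
    ha = p∣-cancelˡ (x - y) (a - c) x≢y (p∣-by₂ 1ℤ -1ℤ hx hy (eq₁ a b c d x y))
    eq₂ : ∀ a b c d x → b - d ≡ 1ℤ · ((a · x + b) - (c · x + d)) + (- x) · (a - c)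
    eq₂ = solve-∀
    hb : p∣ (b - d)
    hb = p∣-by₂ 1ℤ (- x) hx ha (eq₂ a b c d x)

  -- `r` is the second divided difference of the quadratic at `x`, `y`, `z`.
  quadratic-three-roots : ∀ r s t x y z → Distinct x y → Distinct x z → Distinct y z →
    p∣ (r · x · x + s · x + t) → p∣ (r · y · y + s · y + t) → p∣ (r · z · z + s · z + t) → p∣ r
  quadratic-three-roots r s t x y z xy xz yz hx hy hz =
    p∣-cancelˡ (y - z) r yz (p∣-by₂ 1ℤ -1ℤ (slope y xy hy) (slope z xz hz) (eq r s x y z))
    where
    eq : ∀ r s x y z → (y - z) · r ≡ 1ℤ · (r · (x + y) + s) + -1ℤ · (r · (x + z) + s)
    eq = solve-∀
    eq' : ∀ r s t x y → (x - y) · (r · (x + y) + s) ≡ 1ℤ · (r · x · x + s · x + t) + -1ℤ · (r · y · y + s · y + t)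
    eq' = solve-∀
    slope : ∀ y → Distinct x y → p∣ (r · y · y + s · y + t) → p∣ (r · (x + y) + s)
    slope y xy hy = p∣-cancelˡ (x - y) _ xy (p∣-by₂ 1ℤ -1ℤ hx hy (eq' r s t x y))

  -- Lines and their crossings

  -- What the Sudoku rule says about one line at level 0; the zero class of `at` is the exceptional
  -- class of columns.
  record Line (Col : ℤ → Set) (g : ℤ → ℤ) : Set where
    field
      slope const : ℤ
      nonzero     : ¬ (p∣ slope × p∣ const)
      fits        : ∀ x → Col x → Fits g slope const x

    at : ℤ → ℤ
    at x = slope · x + const

    at-unique : ∀ x y → Distinct x y → p∣ at x → p∣ at y → ⊥
    at-unique = root-unique slope const nonzero

  open Line

  reindex : ∀ {Col g g'} → (∀ x → g x ≡ g' x) → Line Col g → Line Col g'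
  reindex e l = record { slope = slope l ; const = const l ; nonzero = nonzero l
    ; fits = λ x c n → subst (λ v → p∣ (at l x - v)) (e x) (fits l x c n) }

  concurrent : ∀ {Col g g'} (l : Line Col g) (l' : Line Col g') x → Col x → g x ≡ g' x →
    ¬ p∣ at l x → ¬ p∣ at l' x → p∣ (at l x - at l' x)
  concurrent {g = g} l l' x c e n n' = p∣-by₂ 1ℤ -1ℤ (fits l x c n)
    (subst (λ v → p∣ (at l' x - v)) (sym e) (fits l' x c n')) (eq (at l x) (at l' x) (g x))
    where
    eq : ∀ u v w → u - v ≡ 1ℤ · (u - w) + -1ℤ · (v - w)
    eq = solve-∀

  -- Abstract in `G`, because the result is applied both to a solution and to the solution obtained
  -- from it by descent. All crossings are arranged to fall in columns 0 to 29.
  module Plane (Col : ℤ → Set) (col : ∀ n → n < 34 → Col (+ n))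
    (G : ℤ → ℤ → ℤ) (lines : ∀ j i → Line Col (λ x → G x (j · x + i))) where

    row : ∀ m → Line Col (λ x → G x m)
    row m = reindex (λ x → cong (G x) (ℤP.+-identityˡ m)) (lines 0ℤ m)

    diag : ∀ c → Line Col (λ x → G x (x - c))
    diag c = reindex (λ x → cong (λ y → G x (y - c)) (ℤP.*-identityˡ x)) (lines 1ℤ (- c))

    antidiag : ∀ e → Line Col (λ x → G x (e - x))
    antidiag e = reindex (λ x → cong (G x) (eq e x)) (lines -1ℤ e)
      where
      eq : ∀ e x → -1ℤ · x + e ≡ e - x
      eq = solve-∀

    crossings : ℤ → ℤ → ℤ → List ℤ
    crossings c e m = (m + c) ∷ (m + (c + 1ℤ)) ∷ (e - m) ∷ []

    Regular : ℤ → ℤ → ℤ → Set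
    Regular c e m = All (λ x → Col x × ¬ p∣ at (row m) x) (crossings c e m)

    IsRow : ℤ → ℤ → ℤ → ℤ → Set
    IsRow A B C m = p∣ (slope (row m) - A) × p∣ (const (row m) - (B · m + C))

    -- The row m meets the two diagonals x = m + c, x = m + c + 1 and the antidiagonal x = e - m.
    -- Interpolating its slope from the diagonals, the antidiagonal gives an equation
    -- quadratic in m, whose leading coefficient is -2 times the difference of the slopes
    -- of the diagonals.
    module Seed (c e : ℤ) where
      d₁ = diag c
      d₂ = diag (c + 1ℤ)
      d₃ = antidiag e
      a₁ = slope d₁
      b₁ = const d₁
      a₂ = slope d₂
      b₂ = const d₂
      a₃ = slope d₃
      b₃ = const d₃

      Meets : ℤ → Set
      Meets m = p∣ (at (row m) (m + c) - at d₁ (m + c))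
              × p∣ (at (row m) (m + (c + 1ℤ)) - at d₂ (m + (c + 1ℤ)))
              × p∣ (at (row m) (e - m) - at d₃ (e - m))

      shift-inj : ∀ c x y → Distinct x y → Distinct (x + c) (y + c)
      shift-inj c x y d h = d (subst p∣_ (eq c x y) h)
        where
        eq : ∀ c x y → (x + c) - (y + c) ≡ x - y
        eq = solve-∀

      flip-inj : ∀ x y → Distinct x y → Distinct (e - x) (e - y)
      flip-inj x y d h = d (p∣-by -1ℤ h (eq e x y))
        where
        eq : ∀ e x y → x - y ≡ -1ℤ · ((e - x) - (e - y))
        eq = solve-∀

      meet : ∀ m → Regular c e m → ¬ p∣ at d₁ (m + c) → ¬ p∣ at d₂ (m + (c + 1ℤ)) → ¬ p∣ at d₃ (e - m) → Meets m
      meet m ((c₁ , r₁) ∷ (c₂ , r₂) ∷ (c₃ , r₃) ∷ []) n₁ n₂ n₃ =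
          concurrent (row m) d₁ (m + c) c₁ (cong (G (m + c)) (eq₁ m c)) r₁ n₁
        , concurrent (row m) d₂ (m + (c + 1ℤ)) c₂ (cong (G (m + (c + 1ℤ))) (eq₁ m (c + 1ℤ))) r₂ n₂
        , concurrent (row m) d₃ (e - m) c₃ (cong (G (e - m)) (eq₂ e m)) r₃ n₃
        where
        eq₁ : ∀ m c → m ≡ m + c - c
        eq₁ = solve-∀
        eq₂ : ∀ e m → m ≡ e - (e - m)
        eq₂ = solve-∀

      -- Lines of slope 1 or -1 cross incongruent rows in incongruent columns, so each of the three
      -- is at its exceptional class on at most one sampled row.
      meets : ∀ {Q : ℤ → Set} → Sample Distinct (λ m → Regular c e m × Q m) 7 →
        Sample Distinct (λ m → Meets m × Q m) 4
      meets rows = refine (λ { {m} (n₃ , n₂ , n₁ , r , q) → meet m r n₁ n₂ n₃ , q })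
        (discard (λ m → p∣? at d₃ (e - m)) (λ x y d → at-unique d₃ (e - x) (e - y) (flip-inj x y d))
        (discard (λ m → p∣? at d₂ (m + (c + 1ℤ)))
          (λ x y d → at-unique d₂ (x + (c + 1ℤ)) (y + (c + 1ℤ)) (shift-inj (c + 1ℤ) x y d))
        (discard (λ m → p∣? at d₁ (m + c)) (λ x y d → at-unique d₁ (x + c) (y + c) (shift-inj c x y d)) rows)))

      -- The `u`s are the values of the three lines on row 0, and `κ` is the slope of row 0
      -- predicted by the two diagonals. `B` and `C` come from solving `on-diag` for the constant of
      -- row `m`, with `κ` as its slope.
      u₁ u₂ u₃ κ A B C : ℤ
      u₁ = at d₁ c
      u₂ = at d₂ (c + 1ℤ)
      u₃ = at d₃ e
      κ = u₂ - u₁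
      A = κ
      B = a₁ - κ
      C = u₁ - κ · c

      module _ (m : ℤ) (met : Meets m) where
        α β v : ℤ
        α = slope (row m)
        β = const (row m)
        v = at (row m) c

        on-diag : p∣ ((α · m + v) - (a₁ · m + u₁))
        on-diag = subst p∣_ (cong₂ _-_ (eq α β m c) (eq a₁ b₁ m c)) (proj₁ met)
          where
          eq : ∀ a b x y → a · (x + y) + b ≡ a · x + (a · y + b)
          eq = solve-∀

        -- The two diagonals cross the row in adjacent columns, so the difference of their values
        -- there is the slope of the row.
        slope-by-diags : p∣ (α - ((a₂ - a₁) · m + κ))
        slope-by-diags = p∣-by₂ 1ℤ -1ℤ
          (subst p∣_ (cong₂ _-_ (eq α β m c) (eq' a₂ b₂ m (c + 1ℤ))) (proj₁ (proj₂ met)))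
          on-diag (eq'' α m v a₁ u₁ a₂ u₂)
          where
          eq : ∀ α β m c → α · (m + (c + 1ℤ)) + β ≡ α · m + (α + (α · c + β))
          eq = solve-∀
          eq' : ∀ a b x y → a · (x + y) + b ≡ a · x + (a · y + b)
          eq' = solve-∀
          eq'' : ∀ α m v a₁ u₁ a₂ u₂ → α - ((a₂ - a₁) · m + (u₂ - u₁)) ≡
            1ℤ · ((α · m + (α + v)) - (a₂ · m + u₂)) + -1ℤ · ((α · m + v) - (a₁ · m + u₁))
          eq'' = solve-∀

        on-antidiag : p∣ (α · ((e - c) - + 2 · m) + ((a₁ + a₃) · m + (u₁ - u₃)))
        on-antidiag = p∣-by₂ 1ℤ -1ℤ
          (subst p∣_ (cong₂ _-_ (eq α β m c e) (eq' a₃ b₃ e m)) (proj₂ (proj₂ met)))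
          on-diag (eq'' α v m (e - c) a₁ u₁ a₃ u₃)
          where
          eq : ∀ α β m c e → α · (e - m) + β ≡ α · ((e - c) - m) + (α · c + β)
          eq = solve-∀
          eq' : ∀ a b e m → a · (e - m) + b ≡ (a · e + b) - a · m
          eq' = solve-∀
          eq'' : ∀ α v m w a u a' u' → α · (w - + 2 · m) + ((a + a') · m + (u - u')) ≡
            1ℤ · ((α · (w - m) + v) - (u' - a' · m)) + -1ℤ · ((α · m + v) - (a · m + u))
          eq'' = solve-∀

        quadratic : p∣ ((- + 2) · (a₂ - a₁) · m · m + ((a₂ - a₁) · (e - c) - + 2 · κ + (a₁ + a₃)) · m
             + (κ · (e - c) + (u₁ - u₃)))
        quadratic = p∣-by₂ 1ℤ (- ((e - c) - + 2 · m)) on-antidiag slope-by-diags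
          (eq α (a₂ - a₁) κ (e - c) m (a₁ + a₃) (u₁ - u₃))
          where
          eq : ∀ α δ κ w m t u → (- + 2) · δ · m · m + (δ · w - + 2 · κ + t) · m + (κ · w + u) ≡
            1ℤ · (α · (w - + 2 · m) + (t · m + u)) + (- (w - + 2 · m)) · (α - (δ · m + κ))
          eq = solve-∀

        -- For parallel diagonals the slope found in `slope-by-diags` is `κ`, independent of `m`;
        -- `on-diag` then gives the constant.
        isRow : p∣ (a₂ - a₁) → IsRow A B C m
        isRow h = hα , p∣-by₂ 1ℤ (- (m + c)) on-diag hα (eq' α β a₁ u₁ κ m c)
          where
          eq : ∀ α δ κ m → α - κ ≡ 1ℤ · (α - (δ · m + κ)) + m · δ
          eq = solve-∀
          hα : p∣ (α - κ)
          hα = p∣-by₂ 1ℤ m slope-by-diags h (eq α (a₂ - a₁) κ m)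
          eq' : ∀ α β a u κ m c → β - ((a - κ) · m + (u - κ · c)) ≡
            1ℤ · ((α · m + (α · c + β)) - (a · m + u)) + (- (m + c)) · (α - κ)
          eq' = solve-∀

      diagonals-parallel : ∀ {Q : ℤ → Set} → Sample Distinct (λ m → Meets m × Q m) 4 → p∣ (a₂ - a₁)
      diagonals-parallel (sample [] _ () _)
      diagonals-parallel (sample (_ ∷ []) _ (s≤s ()) _)
      diagonals-parallel (sample (_ ∷ _ ∷ []) _ (s≤s (s≤s ())) _)
      diagonals-parallel (sample (x ∷ y ∷ z ∷ _) ((xy ∷ xz ∷ _) ∷ (yz ∷ _) ∷ _) _ ((hx , _) ∷ (hy , _) ∷ (hz , _) ∷ _)) =
        p∣-cancelˡ (- + 2) (a₂ - a₁) (p∤2 ∘ ℤS.∣m⇒∣-m)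
          (quadratic-three-roots ((- + 2) · (a₂ - a₁)) ((a₂ - a₁) · (e - c) - + 2 · κ + (a₁ + a₃))
            (κ · (e - c) + (u₁ - u₃)) x y z xy xz yz (quadratic x hx) (quadratic y hy) (quadratic z hz))

      seed : ∀ {Q : ℤ → Set} → Sample Distinct (λ m → Regular c e m × Q m) 7 →
        Sample Distinct (λ m → IsRow A B C m × Q m) 4
      seed rows = refine (λ { {m} (h , q) → isRow m h (diagonals-parallel (meets rows)) , q }) (meets rows)

    -- From four nearby rows to all rows.

    -- Weaker than `IsRow`, which must fail on a row where `A` and `B · m + C` both vanish mod `p`:
    -- the row's own affine function is nonzero. `Good` holds vacuously there.
    Good : ℤ → ℤ → ℤ → ℤ → Set
    Good A B C m = ∀ x → Col x → Fits (λ x → G x m) A (B · m + C) x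

    isRow⇒good : ∀ A B C m → IsRow A B C m → Good A B C m
    isRow⇒good A B C m (h , h') x cx =
      Fits-resp (λ x → G x m) (slope (row m)) (const (row m)) A (B · m + C) x h h' (fits (row m) x cx)

    module Extend (A B C : ℤ) (nonzero-ABC : ¬ (p∣ A × p∣ B × p∣ C)) where

      Transversal : ℤ → Set
      Transversal j = ∀ i → ¬ (p∣ (A + B · j) × p∣ (B · i + C))

      -- If `A + B` and `A - B` both vanish mod `p`, so do `A` and `B` since `p` is odd; then `C`
      -- does not, and every line has a nonzero constant.
      transversal : (Transversal 1ℤ) ⊎ (Transversal -1ℤ)
      transversal with p∣? (A + B · 1ℤ) | p∣? (A + B · -1ℤ)
      ... | no n   | _      = inj₁ (λ _ → n ∘ proj₁)
      ... | yes _  | no n   = inj₂ (λ _ → n ∘ proj₁)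
      ... | yes h₊ | yes h₋ = inj₁ (λ i (_ , h) → nonzero-ABC (hA , hB , p∣-by₂ 1ℤ (- i) h hB (eq₃ B C i)))
        where
        eq₁ : ∀ A B → + 2 · A ≡ 1ℤ · (A + B · 1ℤ) + 1ℤ · (A + B · -1ℤ)
        eq₁ = solve-∀
        eq₂ : ∀ A B → + 2 · B ≡ 1ℤ · (A + B · 1ℤ) + -1ℤ · (A + B · -1ℤ)
        eq₂ = solve-∀
        eq₃ : ∀ B C i → C ≡ 1ℤ · (B · i + C) + (- i) · B
        eq₃ = solve-∀
        hA : p∣ A
        hA = p∣-cancelˡ (+ 2) A p∤2 (p∣-by₂ 1ℤ 1ℤ h₊ h₋ (eq₁ A B))
        hB : p∣ B
        hB = p∣-cancelˡ (+ 2) B p∤2 (p∣-by₂ 1ℤ -1ℤ h₊ h₋ (eq₂ A B))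

      good-on-line : ∀ j i y → Fits (λ x → G x (j · y + i)) A (B · (j · y + i) + C) y →
        Fits (λ y → G y (j · y + i)) (A + B · j) (B · i + C) y
      good-on-line j i y = subst (λ v → Matches v (G y (j · y + i))) (eq A B C j i y)
        where
        eq : ∀ A B C j i y → A · y + (B · (j · y + i) + C) ≡ (A + B · j) · y + (B · i + C)
        eq = solve-∀

      good-off-line : ∀ j i y → Fits (λ y → G y (j · y + i)) (A + B · j) (B · i + C) y →
        Fits (λ x → G x (j · y + i)) A (B · (j · y + i) + C) y
      good-off-line j i y = subst (λ v → Matches v (G y (j · y + i))) (eq A B C j i y)
        where
        eq : ∀ A B C j i y → (A + B · j) · y + (B · i + C) ≡ A · y + (B · (j · y + i) + C)
        eq = solve-∀

      Nearby : ℤ → ℤ → Set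
      Nearby m m' = Good A B C m' × ∣ m' - m ∣ ℕ.≤ 12

      nearby-col : ∀ n d → 12 ℕ.≤ n → n ℕ.≤ 16 → ∣ d ∣ ℕ.≤ 12 → Col (+ n + d)
      nearby-col n (+ d)    _   n≤ d≤ = col (n ℕ.+ d) (ℕP.≤-<-trans (ℕP.+-mono-≤ n≤ d≤) (from-yes (28 ℕ.<? 34)))
      nearby-col n -[1+ d ] ≤n  n≤ d≤ = subst Col (sym (ℤP.⊖-≥ (ℕP.≤-trans d≤ ≤n)))
        (col (n ℕ.∸ suc d) (ℕP.≤-<-trans (ℕP.≤-trans (ℕP.m∸n≤m n (suc d)) n≤) (from-yes (16 ℕ.<? 34))))

      module _ (m : ℤ) (rows : Sample Distinct (Nearby m) 4) where

        -- The line of slope `j` through the point in column `n` of row `m` crosses four good rows.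
        -- By `Fits-unique` its affine function is the restriction of the formula, which therefore
        -- fits at that point too.
        good-at : ∀ j → Transversal j → j · j ≡ 1ℤ → ∣ j ∣ ≡ 1 → ∀ n → 12 ℕ.≤ n → n ℕ.≤ 16 →
          Fits (λ x → G x m) A (B · m + C) (+ n)
        good-at j tr jj ∣j∣ n ≤n n≤ =
          subst (λ m → Fits (λ x → G x m) A (B · m + C) x) (eq₀ j x m)
            (good-off-line j i x (Fits-resp (λ y → G y (j · y + i)) (slope l) (const l) (A + B · j) (B · i + C) x
              (proj₁ same) (proj₂ same) (fits l x cx)))
          where
          x i : ℤ
          x = + n
          i = m - j · x
          cx : Col x
          cx = col n (ℕP.≤-<-trans n≤ (from-yes (16 ℕ.<? 34)))
          l : Line Col (λ y → G y (j · y + i))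
          l = lines j i
          eq₀ : ∀ j x m → j · x + (m - j · x) ≡ m
          eq₀ = solve-∀
          -- The column in which the line crosses row `m'`; dividing by `j` is multiplying by `j`,
          -- as `j · j ≡ 1ℤ`.
          y : ℤ → ℤ
          y m' = x + j · (m' - m)
          on-row : ∀ m' → m' ≡ j · y m' + i
          on-row m' = trans (sym (trans (cong (λ v → v · (m' - m) + m) jj) (eq₂ m m'))) (eq₁ j x m m')
            where
            eq₂ : ∀ m m' → 1ℤ · (m' - m) + m ≡ m'
            eq₂ = solve-∀
            eq₁ : ∀ j x m m' → (j · j) · (m' - m) + m ≡ j · (x + j · (m' - m)) + (m - j · x)
            eq₁ = solve-∀
          y-col : ∀ m' → ∣ m' - m ∣ ℕ.≤ 12 → Col (y m')
          y-col m' h = nearby-col n (j · (m' - m)) ≤n n≤ (subst (ℕ._≤ 12) (sym (trans (ℤP.abs-* j (m' - m))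
            (trans (cong (ℕ._* ∣ m' - m ∣) ∣j∣) (ℕP.*-identityˡ _)))) h)
          y-distinct : ∀ u v → Distinct u v → Distinct (y u) (y v)
          y-distinct u v d h = d (p∣-by j h (trans (sym (trans (cong (_· (u - v)) jj) (ℤP.*-identityˡ _))) (eq j x m u v)))
            where
            eq : ∀ j x m u v → (j · j) · (u - v) ≡ j · ((x + j · (u - m)) - (x + j · (v - m)))
            eq = solve-∀
          both-fit : ∀ {m'} → Nearby m m' →
            Fits (λ y → G y (j · y + i)) (slope l) (const l) (y m') ×
            Fits (λ y → G y (j · y + i)) (A + B · j) (B · i + C) (y m')
          both-fit {m'} (g , near) = fits l (y m') (y-col m' near) ,
            good-on-line j i (y m') (subst (λ v → Good A B C v) (on-row m') g (y m') (y-col m' near))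
          same : p∣ (slope l - (A + B · j)) × p∣ (const l - (B · i + C))
          same = Fits-unique (λ y → G y (j · y + i)) (slope l) (const l) (A + B · j) (B · i + C) (nonzero l) (tr i)
            (image y y-distinct both-fit rows)

        fits-at : ∀ n → 12 ℕ.≤ n → n ℕ.≤ 16 → Fits (λ x → G x m) A (B · m + C) (+ n)
        fits-at with transversal
        ... | inj₁ t = good-at 1ℤ t refl refl
        ... | inj₂ t = good-at -1ℤ t refl refl

        extend-nonzero : ¬ (p∣ A × p∣ (B · m + C)) → Good A B C m
        extend-nonzero nz = isRow⇒good A B C m
          (Fits-unique (λ x → G x m) (slope (row m)) (const (row m)) A (B · m + C) (nonzero (row m)) nz
            (sample columns (allClose⇒allDistinct (from-yes (AllPairs.allPairs? close? columns))) ℕP.≤-refl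
              ( both 13 (from-yes (12 ℕ.≤? 13)) (from-yes (13 ℕ.≤? 16))
              ∷ both 14 (from-yes (12 ℕ.≤? 14)) (from-yes (14 ℕ.≤? 16))
              ∷ both 15 (from-yes (12 ℕ.≤? 15)) (from-yes (15 ℕ.≤? 16))
              ∷ both 16 (from-yes (12 ℕ.≤? 16)) (from-yes (16 ℕ.≤? 16)) ∷ [])))
          where
          columns : List ℤ
          columns = + 13 ∷ + 14 ∷ + 15 ∷ + 16 ∷ []
          both : ∀ n → 12 ℕ.≤ n → n ℕ.≤ 16 →
            Fits (λ x → G x m) (slope (row m)) (const (row m)) (+ n) × Fits (λ x → G x m) A (B · m + C) (+ n)
          both n ≤n n≤ = fits (row m) (+ n) (col n (ℕP.≤-<-trans n≤ (from-yes (16 ℕ.<? 34)))) , fits-at n ≤n n≤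

        extend : Good A B C m
        extend with p∣? A | p∣? (B · m + C)
        -- Degenerate row: the formula vanishes mod `p` at every column, so nothing has to be
        -- matched.
        ... | yes hA | yes hC = λ x _ n → contradiction (p∣-by₂ x 1ℤ hA hC (eq A (B · m + C) x)) n
          where
          eq : ∀ A c x → A · x + c ≡ x · A + 1ℤ · c
          eq = solve-∀
        ... | no n | _ = extend-nonzero (n ∘ proj₁)
        ... | yes _ | no n = extend-nonzero (n ∘ proj₂)

      offsets : List ℤ
      offsets = + 0 ∷ + 1 ∷ + 2 ∷ + 3 ∷ []

      Block : ℤ → Set
      Block m = All (λ a → Good A B C (a + m)) offsets

      block⇒good : ∀ m → Block m → ∀ t → All (λ a → ∣ a - t ∣ ℕ.≤ 12) offsets → Good A B C (t + m)
      block⇒good m block t near = extend (t + m) (image (_+ m)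
        (λ x y d h → d (subst p∣_ (eq x y m) h))
        (λ {a} (g , l) → g , subst (λ v → ∣ v ∣ ℕ.≤ 12) (sym (eq a t m)) l)
        (sample offsets (allClose⇒allDistinct (from-yes (AllPairs.allPairs? close? offsets)))
          ℕP.≤-refl (All.zip (block , near))))
        where
        eq : ∀ x y m → (x + m) - (y + m) ≡ x - y
        eq = solve-∀

      within? : ∀ t → Dec (All (λ a → ∣ a - t ∣ ℕ.≤ 12) offsets)
      within? t = All.all? (λ a → ∣ a - t ∣ ℕ.≤? 12) offsets

      -- Each row of the shifted block is within distance 12 of all four rows of the old one, so
      -- `extend` reaches it.
      block-shift : ∀ s → All (λ b → All (λ a → ∣ a - (b + s) ∣ ℕ.≤ 12) offsets) offsets →
        ∀ m → Block m → Block (s + m)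
      block-shift s near m block =
        All.map (λ {b} n → subst (Good A B C) (ℤP.+-assoc b s m) (block⇒good m block (b + s) n)) near

      block-everywhere : Block 0ℤ → ∀ m → Block m
      block-everywhere b (+ zero)     = b
      block-everywhere b (+ suc n)    =
        block-shift 1ℤ (from-yes (All.all? (λ b → within? (b + 1ℤ)) offsets)) (+ n) (block-everywhere b (+ n))
      block-everywhere b -[1+ zero ]  =
        block-shift -1ℤ (from-yes (All.all? (λ b → within? (b + -1ℤ)) offsets)) 0ℤ b
      block-everywhere b -[1+ suc n ] =
        block-shift -1ℤ (from-yes (All.all? (λ b → within? (b + -1ℤ)) offsets)) -[1+ n ] (block-everywhere b -[1+ n ])

      good-everywhere : Block 0ℤ → ∀ m → Good A B C m
      good-everywhere b m = subst (Good A B C) (ℤP.+-identityˡ m) (All.head (block-everywhere b m))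

    -- The initial window of thirteen rows.

    Small : ℤ → Set
    Small x = + ∣ x ∣ ≡ x × ∣ x ∣ < 34

    small? : Decidable Small
    small? x = (+ ∣ x ∣ ℤ.≟ x) ×-dec (∣ x ∣ ℕ.<? 34)

    small⇒col : ∀ {x} → Small x → Col x
    small⇒col {x} (e , l) = subst Col e (col ∣ x ∣ l)

    -- For rows 0 to 12 the diagonals use columns `m` to `m + 3`, at most 15, and the antidiagonals
    -- `28 - m` and `29 - m`, at least 16. So the six columns are different, and incongruent mod
    -- `p`.
    crossings₁ crossings₂ : ℤ → List ℤ
    crossings₁ = crossings (+ 0) (+ 28)
    crossings₂ = crossings (+ 2) (+ 29)

    Window : ℤ → Set
    Window m = All Small (crossings₁ m) × All Small (crossings₂ m)
             × All (λ y → All (λ x → Close x y) (crossings₁ m)) (crossings₂ m)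
             -- Lets the seeded rows reach rows 0 to 3, which form the first block.
             × All (λ t → ∣ m - t ∣ ℕ.≤ 12) (+ 0 ∷ + 1 ∷ + 2 ∷ + 3 ∷ [])

    window? : Decidable Window
    window? m = All.all? small? (crossings₁ m) ×-dec All.all? small? (crossings₂ m)
      ×-dec All.all? (λ y → All.all? (λ x → close? x y) (crossings₁ m)) (crossings₂ m)
      ×-dec All.all? (λ t → ∣ m - t ∣ ℕ.≤? 12) (+ 0 ∷ + 1 ∷ + 2 ∷ + 3 ∷ [])

    -- 13 = 2 · 6 + 1 rows leave 7 regular for the same three lines; each of these lines spoils
    -- at most one more row, which leaves 4.
    window : Sample Distinct Window 13
    window = sample (map +_ (upTo 13))
      (allClose⇒allDistinct (from-yes (AllPairs.allPairs? close? (map +_ (upTo 13)))))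
      ℕP.≤-refl (from-yes (All.all? window? (map +_ (upTo 13))))

    -- The exceptional column of a row is hit by at most one of its six crossings.
    one-regular : ∀ {m} → Window m →
      (Regular (+ 0) (+ 28) m × Window m) ⊎ (Regular (+ 2) (+ 29) m × Window m)
    one-regular {m} w@(s₁ , s₂ , close , _) with All.all? (λ x → ¬? (p∣? at (row m) x)) (crossings₁ m)
    ... | yes all = inj₁ (All.zip (All.map small⇒col s₁ , all) , w)
    ... | no ¬all = inj₂ (All.zip (All.map small⇒col s₂ , All.map unexceptional close) , w)
      where
      unexceptional : ∀ {y} → All (λ x → Close x y) (crossings₁ m) → ¬ p∣ at (row m) y
      unexceptional {y} cl hy =
        ¬all (All.map (λ {x} c hx → at-unique (row m) x y (close⇒distinct x y c) hx hy) cl)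

    Affine : Set
    Affine = Σ ℤ λ A → Σ ℤ λ B → Σ ℤ λ C → ¬ (p∣ A × p∣ B × p∣ C) × (∀ m → Good A B C m)

    seeded⇒affine : ∀ A B C → Sample Distinct (λ m → IsRow A B C m × Window m) 4 → Affine
    seeded⇒affine A B C (sample [] _ () _)
    seeded⇒affine A B C rows@(sample (m ∷ _) _ _ (((hA , hBC) , _) ∷ _)) = A , B , C , nz , good-everywhere block
      where
      -- Otherwise the affine function of a seeded row would vanish identically mod `p`.
      nz : ¬ (p∣ A × p∣ B × p∣ C)
      nz (a , b , c) = nonzero (row m)
        ( p∣-by₂ 1ℤ 1ℤ hA a (eq (slope (row m)) A)
        , p∣-by₂ 1ℤ 1ℤ hBC (p∣-by₂ m 1ℤ b c (eq' B C m)) (eq (const (row m)) (B · m + C)))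
        where
        eq : ∀ x y → x ≡ 1ℤ · (x - y) + 1ℤ · y
        eq = solve-∀
        eq' : ∀ B C m → B · m + C ≡ m · B + 1ℤ · C
        eq' = solve-∀
      open Extend A B C nz
      near : ∀ t → (∀ m → Window m → ∣ m - t ∣ ℕ.≤ 12) → Good A B C (t + 0ℤ)
      near t h = subst (Good A B C) (sym (ℤP.+-identityʳ t))
        (extend t (refine (λ {m} (r , w) → isRow⇒good A B C m r , h m w) rows))
      block : Block 0ℤ
      block = near (+ 0) (λ { _ (_ , _ , _ , h ∷ _) → h })
            ∷ near (+ 1) (λ { _ (_ , _ , _ , _ ∷ h ∷ _) → h })
            ∷ near (+ 2) (λ { _ (_ , _ , _ , _ ∷ _ ∷ h ∷ _) → h })
            ∷ near (+ 3) (λ { _ (_ , _ , _ , _ ∷ _ ∷ _ ∷ h ∷ _) → h }) ∷ []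

    affine : Affine
    affine with majority 6 one-regular window
    ... | inj₁ rows = seeded⇒affine A B C (seed rows) where open Seed (+ 0) (+ 28)
    ... | inj₂ rows = seeded⇒affine A B C (seed rows) where open Seed (+ 2) (+ 29)

  -- Valuations and residues

  1<p : 1 < p
  1<p = ℕP.<-trans (from-yes (1 ℕ.<? 48)) 48<p

  -- After a division by `p` the fuel left over exceeds the fuel that `strip` would give the
  -- quotient; this reconciles the two.
  stripAux-fuel : ∀ k k' n → n ℕ.≤ k → n ℕ.≤ k' → stripAux p k n ≡ stripAux p k' n
  stripAux-fuel zero    zero     zero    _       _        = refl
  stripAux-fuel zero    (suc _)  zero    _       _        = refl
  stripAux-fuel (suc _) zero     zero    _       _        = refl
  stripAux-fuel (suc _) (suc _)  zero    _       _        = refl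
  stripAux-fuel (suc k) (suc k') (suc n) (s≤s l) (s≤s l') with p ℕD.∣? suc n
  ... | no _  = refl
  ... | yes _ = cong (λ r → suc (proj₁ r) , proj₂ r)
    (stripAux-fuel k k' (suc n ℕDM./ p) (ℕP.≤-trans n/p≤n l) (ℕP.≤-trans n/p≤n l'))
    where
    n/p≤n : suc n ℕDM./ p ℕ.≤ n
    n/p≤n = ℕP.≤-pred (ℕDM.m/n<m (suc n) p 1<p)

  stripAux-∤ : ∀ k n → ¬ p ∣ n → stripAux p k n ≡ (0 , n)
  stripAux-∤ zero    n       _ = refl
  stripAux-∤ (suc k) zero    _ = refl
  stripAux-∤ (suc k) (suc n) h with p ℕD.∣? suc n
  ... | yes d = contradiction d h
  ... | no _  = refl

  stripAux-* : ∀ k m n → m ≡ n * p → n ≢ 0 → m ℕ.≤ k →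
    stripAux p k m ≡ (suc (proj₁ (stripAux p n n)) , proj₂ (stripAux p n n))
  stripAux-* k       zero    n e n≢0 _ with ℕP.m*n≡0⇒m≡0∨n≡0 n (sym e)
  ... | inj₁ n≡0 = contradiction n≡0 n≢0
  ... | inj₂ p≡0 = contradiction (subst (1 <_) p≡0 1<p) λ ()
  stripAux-* (suc k) (suc m) n e _ (s≤s l) with p ℕD.∣? suc m
  ... | no h  = contradiction (divides n e) h
  ... | yes _ = cong (λ r → suc (proj₁ r) , proj₂ r)
    (trans (cong (stripAux p k) m/p≡n) (stripAux-fuel k n n (ℕP.≤-trans n≤m l) ℕP.≤-refl))
    where
    m/p≡n : suc m ℕDM./ p ≡ n
    m/p≡n = trans (cong (ℕDM._/ p) e) (ℕDM.m*n/n≡m n p)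
    n≤m : n ℕ.≤ m
    n≤m = subst (ℕ._≤ m) m/p≡n (ℕP.≤-pred (ℕDM.m/n<m (suc m) p 1<p))

  strip : ℤ → ℕ × ℕ
  strip x = stripAux p ∣ x ∣ ∣ x ∣

  νLe⇒ : ∀ r x → νLe p r x → x ≢ 0ℤ × proj₁ (strip x) ℕ.≤ r
  νLe⇒ r (+ suc n)  h = (λ ()) , h
  νLe⇒ r -[1+ n ]   h = (λ ()) , h

  ⇒νLe : ∀ r x → x ≢ 0ℤ → proj₁ (strip x) ℕ.≤ r → νLe p r x
  ⇒νLe r (+ zero)  x≢0 _ = contradiction refl x≢0
  ⇒νLe r (+ suc n) _   h = h
  ⇒νLe r -[1+ n ]  _   h = h

  fp-strip : ∀ x → x ≢ 0ℤ → fp p x ≡ (sign x ◃ proj₂ (strip x)) %ℕ p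
  fp-strip (+ zero)  x≢0 = contradiction refl x≢0
  fp-strip (+ suc n) _   = refl
  fp-strip -[1+ n ]  _   = refl

  p∣0 : p∣ 0ℤ
  p∣0 = ℤS.divides 0ℤ refl

  strip-∤ : ∀ x → ¬ p∣ x → strip x ≡ (0 , ∣ x ∣)
  strip-∤ x h = stripAux-∤ (∣ x ∣) (∣ x ∣) (h ∘ ℤS.∣ᵤ⇒∣)

  strip-* : ∀ x → x ≢ 0ℤ → strip (x · + p) ≡ (suc (proj₁ (strip x)) , proj₂ (strip x))
  strip-* x x≢0 = stripAux-* (∣ x · + p ∣) (∣ x · + p ∣) (∣ x ∣) (ℤP.abs-* x (+ p)) (x≢0 ∘ ℤP.∣i∣≡0⇒i≡0) ℕP.≤-refl

  νLe-∤ : ∀ r x → ¬ p∣ x → νLe p r x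
  νLe-∤ r x h = ⇒νLe r x (λ e → h (subst p∣_ (sym e) p∣0)) (subst (ℕ._≤ r) (sym (cong proj₁ (strip-∤ x h))) z≤n)

  νLe₀⇒∤ : ∀ x → νLe p 0 x → ¬ p∣ x
  νLe₀⇒∤ x v (ℤS.divides q e) with νLe⇒ 0 (q · + p) (subst (νLe p 0) e v)
  ... | x≢0 , l with subst (ℕ._≤ 0) (cong proj₁ (strip-* q (λ q≡0 → x≢0 (cong (_· + p) q≡0)))) l
  ... | ()

  ·p≢0⇒≢0 : ∀ x → x · + p ≢ 0ℤ → x ≢ 0ℤ
  ·p≢0⇒≢0 x h e = h (cong (_· + p) e)

  νLe-·p⁻ : ∀ r x → νLe p (suc r) (x · + p) → νLe p r x
  νLe-·p⁻ r x v with νLe⇒ (suc r) (x · + p) v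
  ... | x≢0 , l = ⇒νLe r x (·p≢0⇒≢0 x x≢0)
    (ℕP.≤-pred (subst (ℕ._≤ suc r) (cong proj₁ (strip-* x (·p≢0⇒≢0 x x≢0))) l))

  νLe-·p⁺ : ∀ r x → νLe p r x → νLe p (suc r) (x · + p)
  νLe-·p⁺ r x v with νLe⇒ r x v
  ... | x≢0 , l = ⇒νLe (suc r) (x · + p) xp≢0 (subst (ℕ._≤ suc r) (sym (cong proj₁ (strip-* x x≢0))) (s≤s l))
    where
    xp≢0 : x · + p ≢ 0ℤ
    xp≢0 e with ℤP.i*j≡0⇒i≡0∨j≡0 x e
    ... | inj₁ x≡0 = x≢0 x≡0
    ... | inj₂ p≡0 = contradiction (subst (1 <_) (ℤP.+-injective p≡0) 1<p) λ ()

  fp-·p : ∀ x r → νLe p r x → fp p (x · + p) ≡ fp p x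
  fp-·p x r v = begin
    fp p (x · + p)                                          ≡⟨ fp-strip (x · + p) xp≢0 ⟩
    (sign (x · + p) ◃ proj₂ (strip (x · + p))) %ℕ p         ≡⟨ cong₂ (λ s n → (s ◃ n) %ℕ p) sgn (cong proj₂ (strip-* x x≢0)) ⟩
    (sign x ◃ proj₂ (strip x)) %ℕ p                         ≡⟨ fp-strip x x≢0 ⟨
    fp p x                                                  ∎
    where
    open ≡-Reasoning
    x≢0 = proj₁ (νLe⇒ r x v)
    xp≢0 = proj₁ (νLe⇒ (suc r) (x · + p) (νLe-·p⁺ r x v))
    sgn : sign (x · + p) ≡ sign x
    sgn = trans (ℤP.sign-* x (+ p) {{ℤ.≢-nonZero xp≢0}}) (SignP.*-identityʳ (sign x))

  fp-∤ : ∀ x → ¬ p∣ x → fp p x ≡ x %ℕ p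
  fp-∤ x h = trans (fp-strip x (λ e → h (subst p∣_ (sym e) p∣0)))
    (cong (_%ℕ p) (trans (cong (λ r → sign x ◃ proj₂ r) (strip-∤ x h)) (ℤP.◃-inverse x)))

  p∣x-x%p : ∀ x → p∣ (x - + (x %ℕ p))
  p∣x-x%p x = ℤS.divides (x /ℕ p) (trans (cong (_- + (x %ℕ p)) (ℤDM.a≡a%ℕn+[a/ℕn]*n x p)) (eq (+ (x %ℕ p)) (x /ℕ p · + p)))
    where
    eq : ∀ r q → r + q - r ≡ q
    eq = solve-∀

  residue-unique : ∀ u v → u < p → v < p → p∣ (+ u - + v) → u ≡ v
  residue-unique u v u<p v<p h with u ℕ.≟ v
  ... | yes e = e
  ... | no u≢v = contradiction h (0<∣x∣<p⇒p∤x (+ u - + v)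
    (ℕP.n≢0⇒n>0 (λ e → u≢v (ℤP.+-injective (ℤP.i-j≡0⇒i≡j (+ u) (+ v) (ℤP.∣i∣≡0⇒i≡0 e)))))
    (ℕP.≤-<-trans (subst (ℕ._≤ u ℕ.⊔ v) (cong ∣_∣ (sym (ℤP.m-n≡m⊖n u v))) (ℤP.∣m⊝n∣≤m⊔n u v)) (ℕP.⊔-lub u<p v<p)))

  ≡fp⇒p∣ : ∀ x v → ¬ p∣ x → v ≡ fp p x → p∣ (x - + v)
  ≡fp⇒p∣ x v h e = subst (λ w → p∣ (x - + w)) (sym (trans e (fp-∤ x h))) (p∣x-x%p x)

  p∣⇒≡fp : ∀ x v → ¬ p∣ x → v < p → p∣ (x - + v) → v ≡ fp p x
  p∣⇒≡fp x v h v<p hv = trans (residue-unique v (x %ℕ p) v<p (ℤDM.n%ℕd<d x p)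
    (p∣-by₂ 1ℤ -1ℤ (p∣x-x%p x) hv (eq x (+ (x %ℕ p)) (+ v)))) (sym (fp-∤ x h))
    where
    eq : ∀ x y v → v - y ≡ 1ℤ · (x - y) + -1ℤ · (x - v)
    eq = solve-∀

  inverse : ∀ x → ¬ p∣ x → Σ ℤ λ u → p∣ (x · u - 1ℤ)
  inverse x h = go (coprime-Bézout (prime⇒coprime p-prime {{ℕ.≢-nonZero n≢0}} (ℤDM.n%ℕd<d x p)))
    where
    n = x %ℕ p
    n≢0 : n ≢ 0
    n≢0 e = h (subst p∣_ (trans (cong (λ v → x - + v) e) (ℤP.+-identityʳ x)) (p∣x-x%p x))
    go : Bézout.Identity 1 p n → _
    go (Bézout.+- s t e) = - + t , p∣-by₂ (- + t) -1ℤ (p∣x-x%p x) (ℤS.divides (+ s) refl)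
      (trans (eq x (+ n) (+ t)) (cong (λ v → (- + t) · (x - + n) + -1ℤ · v) e'))
      where
      e' : 1ℤ + + t · + n ≡ + s · + p
      e' = trans (trans (cong (λ v → 1ℤ + v) (sym (ℤP.pos-* t n))) (cong +_ e)) (ℤP.pos-* s p)
      eq : ∀ x n t → x · (- t) - 1ℤ ≡ (- t) · (x - n) + -1ℤ · (1ℤ + t · n)
      eq = solve-∀
    go (Bézout.-+ s t e) = + t , p∣-by₂ (+ t) 1ℤ (p∣x-x%p x) (ℤS.divides (+ s) refl)
      (trans (eq x (+ n) (+ t)) (cong (λ v → + t · (x - + n) + 1ℤ · v) (trans (cong (_- 1ℤ) (sym e')) (eq' (+ s · + p)))))
      where
      e' : 1ℤ + + s · + p ≡ + t · + n
      e' = trans (trans (cong (λ v → 1ℤ + v) (sym (ℤP.pos-* s p))) (cong +_ e)) (ℤP.pos-* t n)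
      eq : ∀ x n t → x · t - 1ℤ ≡ t · (x - n) + 1ℤ · (t · n - 1ℤ)
      eq = solve-∀
      eq' : ∀ v → 1ℤ + v - 1ℤ ≡ v
      eq' = solve-∀

  -- Descent to the points divisible by p

  -- A nonzero affine function has at most one root mod `p`, so it cannot vanish at both 0 and 1.
  unit-value : ∀ A C → ¬ (p∣ A × p∣ C) → Σ ℕ λ c → c < 2 × ¬ p∣ (A · + c + C)
  unit-value A C nz with p∣? (A · + 0 + C)
  ... | no h  = 0 , s≤s z≤n , h
  ... | yes h = 1 , s≤s (s≤s z≤n) , λ h' → root-unique A C nz (+ 0) (+ 1) (close⇒distinct (+ 0) (+ 1) (s≤s z≤n , s≤s z≤n)) h h'

  module Sudoku (N : ℕ) (p²≤N : p * p ℕ.≤ N) where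

    Col : ℤ → Set
    Col x = Σ ℕ λ n → x ≡ + n × n < N

    p≤N : p ℕ.≤ N
    p≤N = ℕP.≤-trans (ℕP.m≤m*n p p) p²≤N

    col : ∀ n → n < 34 → Col (+ n)
    col n l = n , refl , ℕP.<-≤-trans l (ℕP.≤-trans (from-yes (34 ℕ.≤? 48)) (ℕP.≤-trans (ℕP.<⇒≤ 48<p) p≤N))

    value : (ℕ → ℤ → ℕ) → ℤ → ℤ → ℤ
    value F x m = + F ∣ x ∣ m

    lines : ∀ F → SudokuSolution p N F → ∀ j i → Line Col (λ x → value F x (j · x + i))
    lines F sol j i with sol j i
    ... | a , b , nz , h = record
      { slope = a ; const = b
      ; nonzero = λ (ha , hb) → nz (ℤS.∣⇒∣ᵤ ha , ℤS.∣⇒∣ᵤ hb)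
      ; fits = λ { x (n , refl , l) ∤ → ≡fp⇒p∣ (a · + n + b) (F n (j · + n + i)) ∤ (h n l (νLe-∤ 1 _ ∤)) } }

    Affine : (ℕ → ℤ → ℕ) → ℤ → ℤ → ℤ → Set
    Affine F A B C = ∀ m x → Col x → Fits (λ x → value F x m) A (B · m + C) x

    IsAffine : (ℕ → ℤ → ℕ) → Set
    IsAffine F = Σ ℤ λ A → Σ ℤ λ B → Σ ℤ λ C → ¬ (p∣ A × p∣ B × p∣ C) × Affine F A B C

    Represents : ℕ → (ℕ → ℤ → ℕ) → ℤ → ℤ → ℤ → Set
    Represents r F A B C = ∀ n → n < N → ∀ m → νLe p r (A · + n + B · m + C) → F n m ≡ fp p (A · + n + B · m + C)

    represents⇒affine : ∀ r F A B C → Represents r F A B C → Affine F A B C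
    represents⇒affine r F A B C rep m _ (n , refl , l) =
      subst (λ v → Matches v (+ F n m)) (ℤP.+-assoc (A · + n) (B · m) C)
        (λ ∤ → ≡fp⇒p∣ (A · + n + B · m + C) (F n m) ∤ (rep n l m (νLe-∤ r _ ∤)))

    affine⇒represents₀ : ∀ F A B C → ValuedInUnits p N F → Affine F A B C → Represents 0 F A B C
    affine⇒represents₀ F A B C val aff n l m v =
      p∣⇒≡fp x (F n m) ∤ (proj₁ (val n l m))
        (subst (λ v → Matches v (+ F n m)) (sym (ℤP.+-assoc (A · + n) (B · m) C)) (aff m (+ n) (n , refl , l)) ∤)
      where
      x = A · + n + B · m + C
      ∤ : ¬ p∣ x
      ∤ = νLe₀⇒∤ x v

    tetris : (ℕ → ℤ → ℕ) → ℤ → ℤ → ℕ → ℤ → ℕ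
    tetris F α γ n m = F n (α · + n + γ + + p · m)

    -- The change of coordinates sends the line with slope `j` and intercept `i` to the one with
    -- slope `α + p j` and intercept `γ + p i`.
    tetris-solution : ∀ F α γ → SudokuSolution p N F → SudokuSolution p N (tetris F α γ)
    tetris-solution F α γ sol j i with sol (α + + p · j) (γ + + p · i)
    ... | a , b , nz , h = a , b , nz , λ n l v → trans (cong (F n) (eq α γ (+ p) j i (+ n))) (h n l v)
      where
      eq : ∀ α γ q j i n → α · n + γ + q · (j · n + i) ≡ (α + q · j) · n + (γ + q · i)
      eq = solve-∀

    -- By `hα` and `hγ` the form `A n + B m + C` is congruent to `B (m - α n - γ)`, so its zeros mod
    -- `p` are exactly the points that `F'` parametrizes.
    module Descent (F : ℕ → ℤ → ℕ) (sol : SudokuSolution p N F) (A B C : ℤ) (p∤B : ¬ p∣ B)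
      (aff : Affine F A B C) (α γ : ℤ) (hα : p∣ (B · α + A)) (hγ : p∣ (B · γ + C)) where

      F' : ℕ → ℤ → ℕ
      F' = tetris F α γ

      -- The line m = (α + 1) n + γ - c reads B (n - c) on level 0, and meets F' at the
      -- points (c + p k , k).
      module _ (A' B' C' : ℤ) (aff' : Affine F' A' B' C') (c : ℕ) (c<2 : c < 2)
        (nz' : ¬ (p∣ B' × p∣ (A' · + c + C'))) where

        J I : ℤ
        J = α + 1ℤ
        I = γ - + c

        rule : InRule p N (λ n → F n (J · + n + I))
        rule = sol J I

        a b : ℤ
        a = proj₁ rule
        b = proj₁ (proj₂ rule)

        l : Line Col (λ x → value F x (J · x + I))
        l = lines F sol J I

        level₀ : ∀ x → Col x → Fits (λ x → value F x (J · x + I)) B (- (B · + c)) x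
        level₀ x cx = Matches-resp (A · x + (B · (J · x + I) + C)) (B · x + - (B · + c)) (value F x (J · x + I))
          (p∣-by₂ x 1ℤ hα hγ (eq A B C α γ (+ c) x)) (aff (J · x + I) x cx)
          where
          eq : ∀ A B C α γ c x → A · x + (B · ((α + 1ℤ) · x + (γ - c)) + C) - (B · x + - (B · c)) ≡
            x · (B · α + A) + 1ℤ · (B · γ + C)
          eq = solve-∀

        columns : List ℤ
        columns = + 2 ∷ + 3 ∷ + 4 ∷ + 5 ∷ []

        same₀ : p∣ (a - B) × p∣ (b - (- (B · + c)))
        same₀ = Fits-unique (λ x → value F x (J · x + I)) a b B (- (B · + c)) (nonzero l) (p∤B ∘ proj₁)
          (sample columns (allClose⇒allDistinct (from-yes (AllPairs.allPairs? close? columns))) ℕP.≤-refl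
            (both 2 (from-yes (2 ℕ.<? 34)) ∷ both 3 (from-yes (3 ℕ.<? 34))
              ∷ both 4 (from-yes (4 ℕ.<? 34)) ∷ both 5 (from-yes (5 ℕ.<? 34)) ∷ []))
          where
          both : ∀ n → n < 34 → Fits (λ x → value F x (J · x + I)) a b (+ n)
                              × Fits (λ x → value F x (J · x + I)) B (- (B · + c)) (+ n)
          both n h = fits l (+ n) (col n h) , level₀ (+ n) (col n h)

        p∣ac+b : p∣ (a · + c + b)
        p∣ac+b = p∣-by₂ (+ c) 1ℤ (proj₁ same₀) (proj₂ same₀) (eq a b B (+ c))
          where
          eq : ∀ a b B c → a · c + b ≡ c · (a - B) + 1ℤ · (b - (- (B · c)))
          eq = solve-∀

        q : ℤ
        q = ℤS._∣_.quotient p∣ac+b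

        point : ℕ → ℕ
        point k = c ℕ.+ k * p

        -- `c + k p < p + k p`, which is at most `4 p`, hence at most `p * p`.
        point<N : ∀ k → k < 4 → point k < N
        point<N k k<4 = ℕP.<-≤-trans (ℕP.+-monoˡ-< (k * p) (ℕP.<-≤-trans c<2 1<p))
          (ℕP.≤-trans (ℕP.*-monoˡ-≤ p k<4) (ℕP.≤-trans (ℕP.*-monoˡ-≤ p (ℕP.≤-trans (from-yes (4 ℕ.≤? 48)) (ℕP.<⇒≤ 48<p))) p²≤N))

        +point : ∀ k → + point k ≡ + c + + k · + p
        +point k = trans (ℤP.pos-+ c (k * p)) (cong (λ v → + c + v) (ℤP.pos-* k p))

        value' : ℤ → ℤ
        value' y = + F' (point ∣ y ∣) y

        -- At `point k` the rule's argument is `p (a k + q)`, of valuation 1 when `a k + q` is a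
        -- unit. Here the rule is applied at valuation 1, not only 0.
        level₁ : ∀ k → k < 4 → Fits value' a q (+ k)
        level₁ k k<4 ∤ = ≡fp⇒p∣ (a · + k + q) (F' n (+ k)) ∤ (begin
          F' n (+ k)                       ≡⟨ cong (F n) same-point ⟨
          F n (J · + n + I)                ≡⟨ proj₂ (proj₂ (proj₂ rule)) n (point<N k k<4)
                                                (subst (νLe p 1) (sym factor) (νLe-·p⁺ 0 (a · + k + q) (νLe-∤ 0 _ ∤))) ⟩
          fp p (a · + n + b)               ≡⟨ cong (fp p) factor ⟩
          fp p ((a · + k + q) · + p)       ≡⟨ fp-·p (a · + k + q) 0 (νLe-∤ 0 _ ∤) ⟩
          fp p (a · + k + q)               ∎)
          where
          open ≡-Reasoning
          n : ℕ
          n = point k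
          same-point : J · + n + I ≡ α · + n + γ + + p · + k
          same-point = trans (eq₁ α γ (+ c) (+ n)) (trans (cong (λ v → α · + n + γ + (v - + c)) (+point k))
            (eq₂ (α · + n + γ) (+ c) (+ k) (+ p)))
            where
            eq₁ : ∀ α γ c n → (α + 1ℤ) · n + (γ - c) ≡ α · n + γ + (n - c)
            eq₁ = solve-∀
            eq₂ : ∀ u c k p → u + (c + k · p - c) ≡ u + p · k
            eq₂ = solve-∀
          factor : a · + n + b ≡ (a · + k + q) · + p
          factor = trans (cong (λ v → a · v + b) (+point k)) (trans (eq₁ a b (+ c) (+ k) (+ p))
            (trans (cong (λ v → a · (+ k · + p) + v) (ℤS._∣_.equality p∣ac+b)) (eq₂ a q (+ k) (+ p))))
            where
            eq₁ : ∀ a b c k p → a · (c + k · p) + b ≡ a · (k · p) + (a · c + b)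
            eq₁ = solve-∀
            eq₂ : ∀ a q k p → a · (k · p) + q · p ≡ (a · k + q) · p
            eq₂ = solve-∀

        level₁' : ∀ k → k < 4 → Fits value' B' (A' · + c + C') (+ k)
        level₁' k k<4 = Matches-resp (A' · + point k + (B' · + k + C')) (B' · + k + (A' · + c + C')) (value' (+ k))
          (ℤS.divides (A' · + k) (trans (cong (λ v → A' · v + (B' · + k + C') - (B' · + k + (A' · + c + C'))) (+point k))
            (eq A' B' C' (+ c) (+ k) (+ p))))
          (aff' (+ k) (+ point k) (point k , refl , point<N k k<4))
          where
          eq : ∀ A B C c k p → A · (c + k · p) + (B · k + C) - (B · k + (A · c + C)) ≡ A · k · p
          eq = solve-∀

        heights : List ℤ
        heights = + 0 ∷ + 1 ∷ + 2 ∷ + 3 ∷ []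

        -- The coefficient `a` of one line is read twice: level 0 makes it congruent to `B`, level 1
        -- to `B'`.
        slope-preserved-at : p∣ (B - B')
        slope-preserved-at = p∣-by₂ 1ℤ -1ℤ (proj₁ same₁) (proj₁ same₀) (eq a B B')
          where
          both : ∀ k → k < 4 → Fits value' a q (+ k) × Fits value' B' (A' · + c + C') (+ k)
          both k h = level₁ k h , level₁' k h
          same₁ : p∣ (a - B') × p∣ (q - (A' · + c + C'))
          same₁ = Fits-unique value' a q B' (A' · + c + C') (λ (h , _) → p∤B (p∣x-y⇒p∣x⇒p∣y a B (proj₁ same₀) h)) nz'
            (sample heights (allClose⇒allDistinct (from-yes (AllPairs.allPairs? close? heights))) ℕP.≤-refl
              (both 0 (from-yes (0 ℕ.<? 4)) ∷ both 1 (from-yes (1 ℕ.<? 4))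
                ∷ both 2 (from-yes (2 ℕ.<? 4)) ∷ both 3 (from-yes (3 ℕ.<? 4)) ∷ []))
          eq : ∀ a B B' → B - B' ≡ 1ℤ · (a - B') + -1ℤ · (a - B)
          eq = solve-∀

      slope-preserved : ∀ A' B' C' → ¬ (p∣ A' × p∣ B' × p∣ C') → Affine F' A' B' C' → p∣ (B - B')
      slope-preserved A' B' C' nz aff' with p∣? B'
      -- The column `c` must keep `B' k + (A' c + C')` from vanishing identically in `k`: any `c`
      -- does if `p` does not divide `B'`, otherwise `unit-value` supplies one.
      ... | no h  = slope-preserved-at A' B' C' aff' 0 (s≤s z≤n) (h ∘ proj₁)
      ... | yes h with unit-value A' C' (λ (ha , hc) → nz (ha , h , hc))
      ...   | c , c<2 , h' = slope-preserved-at A' B' C' aff' c c<2 (h' ∘ proj₂)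

      module Ascend (r : ℕ) (A' B' C' : ℤ) (val : ValuedInUnits p N F) (p∤B' : ¬ p∣ B') (hB : p∣ (B - B'))
        (rep : Represents r F' A' B' C') (n : ℕ) (n<N : n < N) (m : ℤ) where

        x d : ℤ
        -- This is `p (A' n + B' k + C')` with `p k` replaced by `d`, that is,
        -- `B' d + p (A' n + C')`.
        x = (+ p · A' - B' · α) · + n + B' · m + (+ p · C' - B' · γ)
        d = m - (α · + n + γ)

        on-level : p∣ d → νLe p (suc r) x → F n m ≡ fp p x
        on-level (ℤS.divides k e) v = begin
          F n m                 ≡⟨ cong (F n) m≡ ⟩
          F' n k                ≡⟨ rep n n<N k v' ⟩
          fp p y                ≡⟨ fp-·p y r v' ⟨
          fp p (y · + p)        ≡⟨ cong (fp p) x≡ ⟨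
          fp p x                ∎
          where
          open ≡-Reasoning
          y : ℤ
          y = A' · + n + B' · k + C'
          m≡ : m ≡ α · + n + γ + + p · k
          m≡ = trans (eq m (α · + n + γ)) (cong (λ v → α · + n + γ + v) (trans e (ℤP.*-comm k (+ p))))
            where
            eq : ∀ m t → m ≡ t + (m - t)
            eq = solve-∀
          x≡ : x ≡ y · + p
          x≡ = trans (cong (λ m → (+ p · A' - B' · α) · + n + B' · m + (+ p · C' - B' · γ)) m≡)
            (eq A' B' C' α γ (+ n) k (+ p))
            where
            eq : ∀ A B C α γ n k p → (p · A - B · α) · n + B · (α · n + γ + p · k) + (p · C - B · γ) ≡
              (A · n + B · k + C) · p
            eq = solve-∀
          v' : νLe p r y
          v' = νLe-·p⁻ r y (subst (νLe p (suc r)) x≡ v)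

        -- Mod `p`, `x` is `B' d`, hence `B d`, hence the level 0 form `z`; this is where `B` and
        -- `B'` must agree.
        off-level : ¬ p∣ d → F n m ≡ fp p x
        off-level ∤d = p∣⇒≡fp x (F n m) ∤x (proj₁ (val n n<N m))
          (Matches-resp z x (+ F n m) z≡x (aff m (+ n) (n , refl , n<N)) ∤x)
          where
          z : ℤ
          z = A · + n + (B · m + C)
          eq₁ : ∀ A B C α γ n m p → (p · A - B · α) · n + B · m + (p · C - B · γ) ≡ B · (m - (α · n + γ)) + (A · n + C) · p
          eq₁ = solve-∀
          x≡ : x ≡ B' · d + (A' · + n + C') · + p
          x≡ = eq₁ A' B' C' α γ (+ n) m (+ p)
          p∣p : p∣ (+ p)
          p∣p = ℤS.∣-refl
          ∤x : ¬ p∣ x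
          ∤x h = ∤d (p∣-cancelˡ B' d p∤B'
            (p∣-by₂ 1ℤ (- (A' · + n + C')) (subst p∣_ x≡ h) p∣p (eq (B' · d) (A' · + n + C') (+ p))))
            where
            eq : ∀ u w p → u ≡ 1ℤ · (u + w · p) + (- w) · p
            eq = solve-∀
          z≡ : p∣ (z - B · d)
          z≡ = p∣-by₂ (+ n) 1ℤ hα hγ (eq A B C α γ (+ n) m)
            where
            eq : ∀ A B C α γ n m → A · n + (B · m + C) - B · (m - (α · n + γ)) ≡ n · (B · α + A) + 1ℤ · (B · γ + C)
            eq = solve-∀
          z≡x : p∣ (z - x)
          z≡x = subst (λ x → p∣ (z - x)) (sym x≡)
            (p∣-by₂ 1ℤ 1ℤ z≡ (p∣-by₂ d (- (A' · + n + C')) hB p∣p refl) (eq z B B' d (A' · + n + C') (+ p)))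
            where
            eq : ∀ z B B' d w p → z - (B' · d + w · p) ≡ 1ℤ · (z - B · d) + 1ℤ · (d · (B - B') + (- w) · p)
            eq = solve-∀

        ascend : νLe p (suc r) x → F n m ≡ fp p x
        ascend v = by-level (p∣? d)
          where
          by-level : Dec (p∣ d) → F n m ≡ fp p x
          by-level (yes h) = on-level h v
          by-level (no h)  = off-level h

    -- Induction on the level and conclusion.

    Representable : ℕ → (ℕ → ℤ → ℕ) → Set
    Representable r F = Σ ℤ λ A → Σ ℤ λ B → Σ ℤ λ C → ¬ p∣ B × Represents r F A B C

    -- The induction carries `p ∤ B` in place of non-constant columns, since `slope-preserved`
    -- passes it on to `F'`.
    affine⇒representable : ∀ r F → ValuedInUnits p N F → SudokuSolution p N F →
      ∀ A B C → ¬ p∣ B → Affine F A B C → Representable r F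
    affine⇒representable zero F val sol A B C p∤B aff = A , B , C , p∤B , affine⇒represents₀ F A B C val aff
    affine⇒representable (suc r) F val sol A B C p∤B aff = descend (Plane.affine Col col (value F') (lines F' sol'))
      where
      u : ℤ
      u = proj₁ (inverse B p∤B)
      -- The solutions mod `p` of `B α + A ≡ 0` and `B γ + C ≡ 0`, with `u` inverse to `B`.
      α γ : ℤ
      α = - (A · u)
      γ = - (C · u)
      root : ∀ X → p∣ (B · (- (X · u)) + X)
      root X = p∣-by (- X) (proj₂ (inverse B p∤B)) (eq B X u)
        where
        eq : ∀ B X u → B · (- (X · u)) + X ≡ (- X) · (B · u - 1ℤ)
        eq = solve-∀
      open Descent F sol A B C p∤B aff α γ (root A) (root C)
      sol' : SudokuSolution p N F'
      sol' = tetris-solution F α γ sol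
      p∤-resp : ∀ B' → p∣ (B - B') → ¬ p∣ B'
      p∤-resp B' h h' = p∤B (p∣-by₂ 1ℤ 1ℤ h h' (eq B B'))
        where
        eq : ∀ x y → x ≡ 1ℤ · (x - y) + 1ℤ · y
        eq = solve-∀
      lift : Representable r F' → Representable (suc r) F
      lift (A' , B' , C' , p∤B' , rep) = + p · A' - B' · α , B' , + p · C' - B' · γ , p∤B' ,
        Ascend.ascend r A' B' C' val p∤B'
          -- The triple returned by the induction may differ from the one fed into it, so its `B'`
          -- is compared with `B` afresh.
          (slope-preserved A' B' C' (p∤B' ∘ proj₁ ∘ proj₂) (represents⇒affine r F' A' B' C' rep)) rep
      descend : IsAffine F' → Representable (suc r) F
      descend (A' , B' , C' , nz , aff') = lift (affine⇒representable r F' (λ n l m → val n l _) sol' A' B' C'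
        (p∤-resp B' (slope-preserved A' B' C' nz aff')) aff')

    -- If `p` divided `B`, the formula would not depend on `m` mod `p`; a column where `A c + C` is
    -- a unit would then be constant.
    nonConstantColumns⇒p∤B : ∀ F → ValuedInUnits p N F → NonConstantColumns N F →
      ∀ A B C → ¬ (p∣ A × p∣ B × p∣ C) → Affine F A B C → ¬ p∣ B
    nonConstantColumns⇒p∤B F val nonconst A B C nz aff h = absurd (unit-value A C (λ (a , c) → nz (a , h , c)))
      where
      module _ (c : ℕ) (c<2 : c < 2) (∤ : ¬ p∣ (A · + c + C)) where
        c<N : c < N
        c<N = ℕP.<-≤-trans c<2 (ℕP.≤-trans 1<p p≤N)
        value-at : ∀ m → p∣ (A · + c + C - + F c m)
        value-at m = Matches-resp (A · + c + (B · m + C)) (A · + c + C) (+ F c m)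
          (p∣-by m h (eq A B C (+ c) m)) (aff m (+ c) (c , refl , c<N)) ∤
          where
          eq : ∀ A B C c m → A · c + (B · m + C) - (A · c + C) ≡ m · B
          eq = solve-∀
        constant : ∀ m m' → F c m ≡ F c m'
        constant m m' = residue-unique (F c m) (F c m') (proj₁ (val c c<N m)) (proj₁ (val c c<N m'))
          (p∣-by₂ 1ℤ -1ℤ (value-at m') (value-at m) (eq (A · + c + C) (+ F c m) (+ F c m')))
          where
          eq : ∀ x u v → u - v ≡ 1ℤ · (x - v) + -1ℤ · (x - u)
          eq = solve-∀
        contra : (Σ ℤ λ m → Σ ℤ λ m' → F c m ≢ F c m') → ⊥
        contra (m , m' , m≢m') = m≢m' (constant m m')
      absurd : (Σ ℕ λ c → c < 2 × ¬ p∣ (A · + c + C)) → ⊥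
      absurd (c , c<2 , ∤) = contra c c<2 ∤ (nonconst c (c<N c c<2 ∤))

    representable : ∀ r F → ValuedInUnits p N F → SudokuSolution p N F → NonConstantColumns N F → Representable r F
    representable r F val sol nonconst = go (Plane.affine Col col (value F) (lines F sol))
      where
      go : IsAffine F → Representable r F
      go (A , B , C , nz , aff) =
        affine⇒representable r F val sol A B C (nonConstantColumns⇒p∤B F val nonconst A B C nz aff) aff

theorem4p9 : (p : ℕ) .{{_ : NonZero p}} → Prime p → 48 < p →
    (N : ℕ) → p * p ∣ N →
    (F : ℕ → ℤ → ℕ) → ValuedInUnits p N F → SudokuSolution p N F → NonConstantColumns N F →
    (r : ℕ) → Σ ℤ λ A → Σ ℤ λ B → Σ ℤ λ C → ¬ (+ p ℤD.∣ B) ×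
    ((n : ℕ) → n < N → (m : ℤ) → νLe p r (A ℤ.* + n ℤ.+ B ℤ.* m ℤ.+ C) →
    F n m ≡ fp p (A ℤ.* + n ℤ.+ B ℤ.* m ℤ.+ C))
theorem4p9 p p-prime 48<p zero _ F val sol nonconst r =
  -- For `N = 0` divisibility gives no bound `p * p ≤ N`, but the board is empty and any `B` prime
  -- to `p` will do.
  0ℤ , 1ℤ , 0ℤ , (λ h → 0<∣x∣<p⇒p∤x 1ℤ (s≤s z≤n) 1<p (ℤS.∣ᵤ⇒∣ h)) , λ n ()
  where open Solution p p-prime 48<p
theorem4p9 p p-prime 48<p N@(suc _) p²∣N F val sol nonconst r =
  Product.map₂ (Product.map₂ (Product.map₂ (Product.map₁ (_∘ ℤS.∣ᵤ⇒∣))))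
    (Solution.Sudoku.representable p p-prime 48<p N (∣⇒≤ p²∣N) r F val sol nonconst)
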